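{- Let $R$ be a nonempty set of positive integers, and let $t$ be the maximum integer in $R$. Then, for all integers $k \ge 0$ and $n \ge 14 + t + 2k$, there exists a $(2+k)$-connected Hamiltonian strongly chordal graph with $n$ vertices that is not $R$-cycle extendable.
   Context: All graphs are finite, undirected, and simple. A graph is Hamiltonian if it has a Hamiltonian cycle (a cycle through all its vertices). A graph is $k$-connected if it is connected after the deletion of any subset of at most $k-1$ vertices. A hole is an induced cycle of length at least $4$. A graph is chordal if it contains no holes. For an integer $k \ge 3$, a $k$-sun is a graph on $2k$ vertices whose vertex set can be partitioned into an independent set $X = \{x_1,\dots,x_k\}$ and a clique $Y=\{y_1,\dots,y_k\}$ such that for every $i\in\{1,\dots,k\}$, $x_i$ is adjacent only to $y_i$ and $y_{(i \bmod k)+1}$. Strongly chordal graphs are chordal graphs without induced $k$-suns for all $k\ge 3$. Let $R$ be a nonempty set of positive integers. A cycle $C$ in a graph $G$ is $R$-extendable if there exists another cycle $C'$ in $G$ whose vertex set consists of all vertices of $C$ and exactly $i$ additional vertices, for some integer $i \in R$. A graph is $R$-cycle extendable if every non-Hamiltonian cycle of the graph is $R$-extendable. -}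

module Defs where

open import Data.Fin using (Fin; zero; suc; toℕ)
open import Data.Fin.Subset using (Subset; _∈_; _∉_; _⊆_; _─_; ∣_∣; ⁅_⁆; ⋃)
open import Data.List using (tabulate)
open import Data.Nat using (ℕ; zero; suc; _+_; _≤_; _<_)
open import Data.Nat.DivMod using (_mod_)
open import Data.Product using (_×_; ∃; ∃-syntax; Σ-syntax)
open import Data.Sum using (_⊎_)
open import Function.Bundles using (_⇔_)
open import Function.Definitions using (Injective)
open import Level using (Level; 0ℓ)
open import Relation.Binary.Construct.Closure.ReflexiveTransitive using (Star)
open import Relation.Binary.Core using (Rel)
open import Relation.Binary.Definitions using (Symmetric; Irreflexive; Decidable)
open import Relation.Binary.PropositionalEquality using (_≡_; _≢_)
open import Relation.Nullary using (¬_)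
open import Relation.Unary using (Pred)

private
  variable
    ℓ : Level
    n : ℕ

record Graph (n : ℕ) : Set₁ where
  infix 4 _∼_ _∼?_
  field
    _∼_    : Rel (Fin n) 0ℓ
    _∼?_   : Decidable _∼_
    sym    : Symmetric _∼_
    irrefl : Irreflexive _≡_ _∼_

-- The cyclic successor i ↦ (i + 1) mod m on {0, …, m - 1}.
next : ∀ {m} → Fin m → Fin m
next {suc m} i = suc (toℕ i) mod suc m

-- A cycle is given by its vertices listed in cyclic order, so each cycle of
-- length m is represented 2m times (choice of start and direction).
record Cycle (G : Graph n) : Set where
  open Graph G
  field
    length    : ℕ
    3≤length  : 3 ≤ length
    vertex    : Fin length → Fin n
    injective : Injective _≡_ _≡_ vertex
    adjacent  : ∀ i → vertex i ∼ vertex (next i)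

  vertices : Subset n
  vertices = ⋃ (tabulate (λ i → ⁅ vertex i ⁆))

open Cycle using (vertices)

IsHamiltonianCycle : {G : Graph n} → Cycle G → Set
IsHamiltonianCycle C = ∀ v → v ∈ vertices C

Hamiltonian : Graph n → Set
Hamiltonian G = Σ[ C ∈ Cycle G ] IsHamiltonianCycle C

-- Connectedness of the graph G − S: any two vertices outside S are joined by
-- a walk all of whose vertices lie outside S.
ConnectedAfterDeleting : Graph n → Subset n → Set
ConnectedAfterDeleting {n} G S = ∀ u v → u ∉ S → v ∉ S → Star Step u v
  where
  open Graph G
  Step : Rel (Fin n) 0ℓ
  Step a b = a ∉ S × b ∉ S × a ∼ b

-- ∣ S ∣ < k says "at most k - 1 vertices" without truncated subtraction.
Connected : ℕ → Graph n → Set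
Connected {n} k G = (S : Subset n) → ∣ S ∣ < k → ConnectedAfterDeleting G S

module _ {G : Graph n} where
  open Graph G

  IsInduced : Cycle G → Set
  IsInduced C = ∀ i j → vertex i ∼ vertex j → j ≡ next i ⊎ i ≡ next j
    where open Cycle C

  IsHole : Cycle G → Set
  IsHole C = 4 ≤ Cycle.length C × IsInduced C

Chordal : Graph n → Set
Chordal G = ¬ (Σ[ C ∈ Cycle G ] IsHole C)

-- An induced subgraph of G that is a k-sun: 2k distinct vertices x i, y i of G
-- among which the adjacencies of G are exactly those of a k-sun.  The indices
-- run over 0, …, k - 1, so (i mod k) + 1 becomes next i.
record InducedSun (G : Graph n) (k : ℕ) : Set where
  open Graph G
  field
    x y           : Fin k → Fin n
    x-injective   : Injective _≡_ _≡_ x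
    y-injective   : Injective _≡_ _≡_ y
    x≢y           : ∀ i j → x i ≢ y j
    x-independent : ∀ i j → ¬ (x i ∼ x j)
    y-clique      : ∀ i j → i ≢ j → y i ∼ y j
    x∼y           : ∀ i j → x i ∼ y j ⇔ (j ≡ i ⊎ j ≡ next i)

StronglyChordal : Graph n → Set
StronglyChordal G = Chordal G × (∀ k → 3 ≤ k → ¬ InducedSun G k)

Extendable : Pred ℕ ℓ → {G : Graph n} → Cycle G → Set ℓ
Extendable R {G} C =
  Σ[ C′ ∈ Cycle G ] ∃[ i ]
    (R i × vertices C ⊆ vertices C′ × ∣ vertices C′ ─ vertices C ∣ ≡ i)

CycleExtendable : Pred ℕ ℓ → Graph n → Set ℓ
CycleExtendable R G = (C : Cycle G) → ¬ IsHamiltonianCycle C → Extendable R C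

IsMaximum : Pred ℕ ℓ → ℕ → Set ℓ
IsMaximum R t = R t × (∀ i → R i → i ≤ t)

{-# OPTIONS --safe #-}

-- The graph: 2 + k hubs adjacent to everything, k solos adjacent to the hubs
-- only, a path of 5 + m vertices (the spine), an apex adjacent to the whole
-- spine, an ear adjacent to the apex and to spine vertex 2, and one leaf at each
-- of the first two and the last two spine vertices (its host).  The gap consists
-- of the m > t spine vertices 3, …, m + 2; a shorter cycle contains exactly the
-- other vertices.
--
-- A cycle through all solos and leaves has every solo between two hubs and every
-- leaf next to at least one hub, which already accounts for both sides of each
-- hub.  Hence every leaf lies next to its host, and no vertex of the remaining
-- fan lies next to a hub.  The ear lies between the apex and spine vertex 2, and
-- the second neighbour of the apex decides everything: if it is the last spine
-- vertex, then the cycle follows the spine through the whole gap, and every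
-- other choice is impossible as soon as the cycle contains a gap vertex.
--
-- Every vertex of a hole or of a sun has two neighbours and a non-neighbour in
-- it, which excludes hubs, solos, leaves and the apex in turn, and what is left
-- is a tree.

module Submission where

open import Defs
open import Data.Empty using (⊥)
open import Data.Fin using (Fin; zero; suc; toℕ; fromℕ; fromℕ<; inject₁; opposite; punchOut)
import Data.Fin as Fin
open import Data.Fin.Patterns using (0F; 1F; 2F; 3F)
open import Data.Fin.Properties
  using (toℕ<n; toℕ-injective; toℕ-fromℕ<; toℕ-fromℕ; toℕ-inject₁; any?; punchOut-injective; injective⇒≤; +↔⊎; *↔×)
import Data.Fin.Properties as Finₚ
open import Data.Fin.Relation.Unary.Top using (view; view-fromℕ; view-inject₁; ‵fromℕ; ‵inject₁)
open import Data.Fin.Subset using (Subset; inside; outside; Nonempty; _∈_; _∉_; _─_; _-_; ∣_∣; ⁅_⁆; ⋃)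
open import Data.Fin.Subset.Properties
  using (x∈⁅x⁆; x∈⁅y⁆⇒x≡y; x∈p∪q⁺; x∈p∪q⁻; ∉⊥; _∈?_; x∈p⇒∣p-x∣<∣p∣; x∈p∧x≢y⇒x∈p-y; x∈p∧x∉q⇒x∈p─q; p─q⊆p; nonempty?; Empty-unique; ∣⊥∣≡0)
open import Data.List using (List; []; _∷_; _++_; length; lookup; tabulate)
open import Data.List.Membership.Propositional using () renaming (_∈_ to _∈ˡ_)
open import Data.List.Membership.Propositional.Properties using (∈-lookup; ∈-++⁺ˡ; ∈-++⁺ʳ; ∈-tabulate⁺)
open import Data.List.Relation.Unary.All using (All; []; _∷_)
import Data.List.Relation.Unary.All as All
open import Data.List.Relation.Unary.AllPairs using (AllPairs; _∷_)
open import Data.List.Relation.Unary.Any using (here; there; index)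
open import Data.List.Relation.Unary.Any.Properties using (lookup-index)
open import Data.List.Relation.Unary.Linked using (Linked; [-]; _∷_)
import Data.List.Relation.Unary.Linked as Linked
open import Data.List.Relation.Unary.Linked.Properties using (Linked⇒AllPairs)
open import Data.Nat using (ℕ; zero; suc; _+_; _*_; _∸_; _≤_; _<_; z≤n; s≤s; z<s; s<s; _≟_)
open import Data.Nat.DivMod using (_%_; m%n<n; m%n%n≡m%n; %-distribˡ-+; m<n⇒m%n≡m; n%n≡0; [m+n]%n≡m%n)
open import Data.Nat.GeneralisedArithmetic using (fold)
open import Data.Nat.Properties
open import Data.Nat.Tactic.RingSolver using (solve-∀)
open import Data.Product using (_×_; _,_; ∃-syntax; Σ-syntax; proj₁; proj₂)
open import Data.Sum using (_⊎_; inj₁; inj₂; [_,_]′)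
open import Data.Sum.Function.Propositional using (_⊎-cong_)
open import Data.Sum.Properties using (inj₁-injective)
open import Data.Unit using (⊤)
open import Data.Vec using ([]; _∷_; here; there)
open import Function using (_∘_; _∋_; _↔_; Inverse; Injection; Injective; Equivalence)
open import Function.Properties.Inverse using (↔⇒↣; ↔-refl; ↔-sym; ↔-trans)
open import Level using (Level)
open import Relation.Binary.Construct.Closure.ReflexiveTransitive using (Star; ε; _◅_; _◅◅_)
open import Relation.Binary.Construct.Closure.Symmetric using (SymClosure; fwd; bwd; symmetric)
open import Relation.Binary.Definitions using (Decidable; tri<; tri≈; tri>)
open import Relation.Binary.PropositionalEquality
open import Relation.Nullary using (¬_; Dec; yes; no; contradiction)
open import Relation.Nullary.Decidable using (map′; ¬?; _×-dec_; decidable-stable)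
open import Relation.Unary using (Pred; Satisfiable)

-- Cyclic successor

infixl 8 _⊕_
_⊕_ : ∀ {L} → Fin L → ℕ → Fin L
i ⊕ r = fold i next r

toℕ-next : ∀ {L} (i : Fin (suc L)) → toℕ (next i) ≡ suc (toℕ i) % suc L
toℕ-next {L} i = toℕ-fromℕ< (m%n<n (suc (toℕ i)) (suc L))

toℕ-⊕ : ∀ {L} (i : Fin (suc L)) r → toℕ (i ⊕ r) ≡ (r + toℕ i) % suc L
toℕ-⊕ i zero = sym (m<n⇒m%n≡m (toℕ<n i))
toℕ-⊕ {L} i (suc r) = begin
  toℕ (next (i ⊕ r))                     ≡⟨ toℕ-next (i ⊕ r) ⟩
  (1 + toℕ (i ⊕ r)) % suc L              ≡⟨ cong (λ e → (1 + e) % suc L) (toℕ-⊕ i r) ⟩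
  (1 + c % suc L) % suc L                ≡⟨ %-distribˡ-+ 1 (c % suc L) (suc L) ⟩
  (1 % suc L + c % suc L % suc L) % suc L ≡⟨ cong (λ e → (1 % suc L + e) % suc L) (m%n%n≡m%n c (suc L)) ⟩
  (1 % suc L + c % suc L) % suc L        ≡⟨ %-distribˡ-+ 1 c (suc L) ⟨
  (1 + c) % suc L                        ∎
  where
  open ≡-Reasoning
  c = r + toℕ i

⊕-length : ∀ {L} (i : Fin L) → i ⊕ L ≡ i
⊕-length {suc L} i = toℕ-injective (begin
  toℕ (i ⊕ suc L)         ≡⟨ toℕ-⊕ i (suc L) ⟩
  (suc L + toℕ i) % suc L ≡⟨ cong (_% suc L) (+-comm (suc L) (toℕ i)) ⟩
  (toℕ i + suc L) % suc L ≡⟨ [m+n]%n≡m%n (toℕ i) (suc L) ⟩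
  toℕ i % suc L           ≡⟨ m<n⇒m%n≡m (toℕ<n i) ⟩
  toℕ i                   ∎)
  where open ≡-Reasoning

⊕-reach : ∀ {L} (i j : Fin L) → ∃[ r ] i ⊕ r ≡ j
⊕-reach {suc L} i j = r , toℕ-injective (begin
  toℕ (i ⊕ r)             ≡⟨ toℕ-⊕ i r ⟩
  (r + toℕ i) % suc L     ≡⟨ cong (_% suc L) r+i ⟩
  (toℕ j + suc L) % suc L ≡⟨ [m+n]%n≡m%n (toℕ j) (suc L) ⟩
  toℕ j % suc L           ≡⟨ m<n⇒m%n≡m (toℕ<n j) ⟩
  toℕ j                   ∎)
  where
  open ≡-Reasoning
  r = toℕ j + (suc L ∸ toℕ i)
  r+i : r + toℕ i ≡ toℕ j + suc L
  r+i = trans (+-assoc (toℕ j) _ (toℕ i)) (cong (toℕ j +_) (m∸n+n≡m (<⇒≤ (toℕ<n i))))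

⊕-≢ : ∀ {L} (i : Fin L) r → 0 < r → r < L → i ⊕ r ≢ i
⊕-≢ {suc L} i r 0<r r<L eq = <⇒≢ 0<r (sym (+-cancelʳ-≡ (toℕ i) r 0 r+i≡i))
  where
  open ≡-Reasoning
  mod≡ : (r + toℕ i) % suc L ≡ toℕ i
  mod≡ = trans (sym (toℕ-⊕ i r)) (cong toℕ eq)
  r+i≡i : r + toℕ i ≡ toℕ i
  r+i≡i with r + toℕ i <? suc L
  ... | yes lt = trans (sym (m<n⇒m%n≡m lt)) mod≡
  -- Both summands are below `suc L`, so subtracting `suc L` once leaves the remainder, which is
  -- `toℕ i` again. That forces `r` to be `suc L`.
  ... | no ¬lt = contradiction (+-cancelˡ-≡ d r (suc L) d+r) (<⇒≢ r<L)
    where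
    d = (r + toℕ i) ∸ suc L
    d+L : d + suc L ≡ r + toℕ i
    d+L = m∸n+n≡m (≮⇒≥ ¬lt)
    d<L : d < suc L
    d<L = +-cancelʳ-< (suc L) d (suc L) (subst (_< suc L + suc L) (sym d+L) (+-mono-< r<L (toℕ<n i)))
    d≡i : d ≡ toℕ i
    d≡i = begin
      d                   ≡⟨ m<n⇒m%n≡m d<L ⟨
      d % suc L           ≡⟨ [m+n]%n≡m%n d (suc L) ⟨
      (d + suc L) % suc L ≡⟨ cong (_% suc L) d+L ⟩
      (r + toℕ i) % suc L ≡⟨ mod≡ ⟩
      toℕ i               ∎
    d+r : d + r ≡ d + suc L
    d+r = trans (trans (cong (_+ r) d≡i) (+-comm (toℕ i) r)) (sym d+L)

-- On a cycle of length `suc L`, one step back is `L` steps forward. Index 0 then needs no separate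
-- case, and `next-prev` is just `⊕-length`.
prev : ∀ {L} → Fin L → Fin L
prev {suc L} i = i ⊕ L

next-prev : ∀ {L} (i : Fin L) → next (prev i) ≡ i
next-prev {suc L} i = ⊕-length i

next-⊕ : ∀ {L} (i : Fin L) r → next i ⊕ r ≡ i ⊕ suc r
next-⊕ i zero = refl
next-⊕ i (suc r) = cong next (next-⊕ i r)

prev-next : ∀ {L} (i : Fin L) → prev (next i) ≡ i
prev-next {suc L} i = trans (next-⊕ i L) (⊕-length i)

next≢ : ∀ {L} → 1 < L → (i : Fin L) → next i ≢ i
next≢ 1<L i = ⊕-≢ i 1 z<s 1<L

next²≢ : ∀ {L} → 2 < L → (i : Fin L) → next (next i) ≢ i
next²≢ 2<L i = ⊕-≢ i 2 z<s 2<L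

next³≢ : ∀ {L} → 3 < L → (i : Fin L) → next (next (next i)) ≢ i
next³≢ 3<L i = ⊕-≢ i 3 z<s 3<L

next≢prev : ∀ {L} → 2 < L → (i : Fin L) → next i ≢ prev i
next≢prev 2<L i eq = next²≢ 2<L i (trans (cong next eq) (next-prev i))

next-cases : ∀ {L} (i : Fin L) → toℕ (next i) ≡ suc (toℕ i) ⊎ toℕ (next i) ≡ 0
next-cases {suc L} i with suc (toℕ i) <? suc L
... | yes lt = inj₁ (trans (toℕ-next i) (m<n⇒m%n≡m lt))
... | no ¬lt = inj₂ (trans (toℕ-next i) (trans (cong (_% suc L) (≤-antisym (toℕ<n i) (≮⇒≥ ¬lt))) (n%n≡0 (suc L))))

-- Lists

Linked-lookup : ∀ {a r} {A : Set a} {R : A → A → Set r} {xs : List A} → Linked R xs →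
  ∀ i j → toℕ j ≡ suc (toℕ i) → R (lookup xs i) (lookup xs j)
Linked-lookup (r ∷ _)  zero    (suc zero)    _  = r
Linked-lookup (_ ∷ rs) (suc i) (suc j)       eq = Linked-lookup rs i j (suc-injective eq)
Linked-lookup [-]      zero    zero          ()
Linked-lookup (_ ∷ _)  zero    (suc (suc _)) ()

AllPairs-lookup : ∀ {a r} {A : Set a} {R : A → A → Set r} {xs : List A} → AllPairs R xs →
  ∀ {i j} → i Fin.< j → R (lookup xs i) (lookup xs j)
AllPairs-lookup (x≺ ∷ _)  {zero}  {suc j} _         = All.lookup x≺ (∈-lookup j)
AllPairs-lookup (_  ∷ ps) {suc i} {suc j} (s<s i<j) = AllPairs-lookup ps i<j

-- Distinctness has to be checked between consecutive entries only: transitivity of `<` carries it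
-- to all pairs.
ranked⇒lookup-injective : ∀ {a} {A : Set a} (rank : A → ℕ) {xs : List A} →
  Linked (λ x y → rank x < rank y) xs → Injective _≡_ _≡_ (lookup xs)
ranked⇒lookup-injective rank linked {i} {j} eq with Finₚ.<-cmp i j
... | tri≈ _ i≡j _ = i≡j
... | tri< i<j _ _ = contradiction (cong rank eq) (<⇒≢ (AllPairs-lookup (Linked⇒AllPairs <-trans linked) i<j))
... | tri> _ _ j<i = contradiction (cong rank (sym eq)) (<⇒≢ (AllPairs-lookup (Linked⇒AllPairs <-trans linked) j<i))

tabulate-linked : ∀ {a r} {A : Set a} {R : A → A → Set r} {n} (f : Fin (suc n) → A) {xs} →
  (∀ i → R (f (inject₁ i)) (f (suc i))) → Linked R (f (fromℕ n) ∷ xs) → Linked R (tabulate f ++ xs)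
tabulate-linked {n = zero}  f step rs = rs
tabulate-linked {n = suc n} f step rs = step zero ∷ tabulate-linked (f ∘ suc) (step ∘ suc) rs

-- Finite sets

-- Pigeonhole: punching a missed value out of the codomain would leave an injection of `Fin (suc n)`
-- into `Fin n`.
injective⇒surjective : ∀ {n} {f : Fin n → Fin n} → Injective _≡_ _≡_ f → ∀ y → ∃[ x ] f x ≡ y
injective⇒surjective {suc n} {f} inj y with any? (λ x → f x Fin.≟ y)
... | yes found = found
... | no  none  = contradiction
  (injective⇒≤ {f = λ x → punchOut (y≢f x)} (λ {i} {j} eq → inj (punchOut-injective (y≢f i) (y≢f j) eq)))
  1+n≰n
  where
  y≢f : ∀ x → y ≢ f x
  y≢f x eq = none (x , sym eq)

↔-injective⇒surjective : ∀ {a b} {A : Set a} {B : Set b} {n} → Fin n ↔ A → Fin n ↔ B →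
  {f : A → B} → Injective _≡_ _≡_ f → ∀ y → ∃[ x ] f x ≡ y
↔-injective⇒surjective α β {f} inj y = A.to (proj₁ pre) , (begin
  f (A.to (proj₁ pre))                      ≡⟨ B.strictlyInverseˡ _ ⟨
  B.to (B.from (f (A.to (proj₁ pre))))      ≡⟨ cong B.to (proj₂ pre) ⟩
  B.to (B.from y)                           ≡⟨ B.strictlyInverseˡ y ⟩
  y                                         ∎)
  where
  open ≡-Reasoning
  module A = Inverse α
  module B = Inverse β
  pre = injective⇒surjective {f = λ i → B.from (f (A.to i))} 
    (λ eq → Injection.injective (↔⇒↣ α) (inj (Injection.injective (↔⇒↣ (↔-sym β)) eq))) (B.from y)

-- Induction on `m`: the values other than `f zero` stay in `S - f zero`, which is strictly smaller
-- than `S`.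
injection⇒≤∣∣ : ∀ {m n} (S : Subset n) (f : Fin m → Fin n) → Injective _≡_ _≡_ f → (∀ i → f i ∈ S) → m ≤ ∣ S ∣
injection⇒≤∣∣ {zero}  S f inj f∈S = z≤n
injection⇒≤∣∣ {suc m} S f inj f∈S = ≤-<-trans
  (injection⇒≤∣∣ (S - f zero) (f ∘ suc) (λ eq → Finₚ.suc-injective (inj eq))
    (λ i → x∈p∧x≢y⇒x∈p-y (f∈S (suc i)) λ eq → contradiction (inj eq) λ ()))
  (x∈p⇒∣p-x∣<∣p∣ (f∈S zero))

0<∣∣⇒nonempty : ∀ {n} (S : Subset n) → 0 < ∣ S ∣ → Nonempty S
0<∣∣⇒nonempty {n} S 0<∣S∣ with nonempty? S
... | yes nonempty = nonempty
... | no  empty    = contradiction (trans (cong ∣_∣ (Empty-unique empty)) (∣⊥∣≡0 n)) (≢-sym (<⇒≢ 0<∣S∣))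

x∈p─q⇒x∉q : ∀ {n} (p q : Subset n) {x} → x ∈ p ─ q → x ∉ q
x∈p─q⇒x∉q (_ ∷ p) (outside ∷ q) (there x∈) (there x∈q) = x∈p─q⇒x∉q p q x∈ x∈q
x∈p─q⇒x∉q (_ ∷ p) (inside ∷ q)  (there x∈) (there x∈q) = x∈p─q⇒x∉q p q x∈ x∈q

∈-⋃-tabulate⁺ : ∀ {m n} (f : Fin m → Subset n) {x} i → x ∈ f i → x ∈ ⋃ (tabulate f)
∈-⋃-tabulate⁺ f zero    x∈ = x∈p∪q⁺ (inj₁ x∈)
∈-⋃-tabulate⁺ f (suc i) x∈ = x∈p∪q⁺ (inj₂ (∈-⋃-tabulate⁺ (f ∘ suc) i x∈))

∈-⋃-tabulate⁻ : ∀ {m n} (f : Fin m → Subset n) {x} → x ∈ ⋃ (tabulate f) → ∃[ i ] x ∈ f i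
∈-⋃-tabulate⁻ {zero}  f x∈ = contradiction x∈ ∉⊥
∈-⋃-tabulate⁻ {suc m} f x∈ with x∈p∪q⁻ (f zero) (⋃ (tabulate (f ∘ suc))) x∈
... | inj₁ x∈f₀ = zero , x∈f₀
... | inj₂ x∈fₛ = let i , x∈fᵢ = ∈-⋃-tabulate⁻ (f ∘ suc) x∈fₛ in suc i , x∈fᵢ

module _ {n} {G : Graph n} (C : Cycle G) where
  open Cycle C

  ∈-vertices⁺ : ∀ i → vertex i ∈ vertices
  ∈-vertices⁺ i = ∈-⋃-tabulate⁺ (λ i → ⁅ vertex i ⁆) i (x∈⁅x⁆ (vertex i))

  ∈-vertices⁻ : ∀ {v} → v ∈ vertices → ∃[ i ] vertex i ≡ v
  ∈-vertices⁻ v∈ = let i , v∈ᵢ = ∈-⋃-tabulate⁻ (λ i → ⁅ vertex i ⁆) v∈ in i , sym (x∈⁅y⁆⇒x≡y _ v∈ᵢ)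

-- The graph

pattern hub i   = inj₁ i
pattern solo i  = inj₂ (inj₁ i)
pattern leaf h  = inj₂ (inj₂ (inj₁ h))
pattern apex    = inj₂ (inj₂ (inj₂ (inj₁ 0F)))
pattern ear     = inj₂ (inj₂ (inj₂ (inj₁ 1F)))
pattern spine j = inj₂ (inj₂ (inj₂ (inj₂ j)))

module Construction (k m : ℕ) where

  open Cycle using (vertices)

  V : Set
  V = Fin (2 + k) ⊎ Fin k ⊎ Fin 4 ⊎ Fin 2 ⊎ Fin (5 + m)

  size : ℕ
  size = (2 + k) + (k + (4 + (2 + (5 + m))))

  abstract
    -- Only the inverse laws are ever used, so no argument depends on which number a vertex
    -- receives.
    decode : Fin size ↔ V
    decode = ↔-trans +↔⊎ (↔-refl ⊎-cong ↔-trans +↔⊎ (↔-refl ⊎-cong ↔-trans +↔⊎ (↔-refl ⊎-cong +↔⊎)))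

  host : Fin 4 → ℕ
  host 0F = 0
  host 1F = 1
  host 2F = 3 + m
  host 3F = 4 + m

  infix 4 _⟶_ _⟶?_ _—_ _—?_

  -- An edge that does not join two hubs is listed in one direction only. Solos, leaves and the ear
  -- receive no arrow, so all their neighbours are found by following arrows.
  data _⟶_ : V → V → Set where
    hub⟶hub     : ∀ {i j} → i ≢ j → hub i ⟶ hub j
    ⟶hub        : ∀ {v i} → inj₂ v ⟶ hub i
    leaf⟶spine  : ∀ {h j} → toℕ j ≡ host h → leaf h ⟶ spine j
    ear⟶apex    : ear ⟶ apex
    ear⟶spine   : ∀ {j} → toℕ j ≡ 2 → ear ⟶ spine j
    spine⟶apex  : ∀ {j} → spine j ⟶ apex
    spine⟶spine : ∀ {i j} → toℕ j ≡ suc (toℕ i) → spine i ⟶ spine j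

  _⟶?_ : Decidable _⟶_
  hub i   ⟶? hub j = map′ hub⟶hub (λ { (hub⟶hub i≢j) → i≢j }) (¬? (i Fin.≟ j))
  hub i   ⟶? inj₂ w = no λ ()
  inj₂ v  ⟶? hub j = yes ⟶hub
  solo i  ⟶? inj₂ w = no λ ()
  leaf h  ⟶? solo i = no λ ()
  leaf h  ⟶? leaf j = no λ ()
  leaf h  ⟶? apex = no λ ()
  leaf h  ⟶? ear = no λ ()
  leaf h  ⟶? spine j = map′ leaf⟶spine (λ { (leaf⟶spine eq) → eq }) (toℕ j ≟ host h)
  apex    ⟶? inj₂ w = no λ ()
  ear     ⟶? solo i = no λ ()
  ear     ⟶? leaf h = no λ ()
  ear     ⟶? apex = yes ear⟶apex
  ear     ⟶? ear = no λ ()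
  ear     ⟶? spine j = map′ ear⟶spine (λ { (ear⟶spine eq) → eq }) (toℕ j ≟ 2)
  spine i ⟶? solo j = no λ ()
  spine i ⟶? leaf h = no λ ()
  spine i ⟶? apex = yes spine⟶apex
  spine i ⟶? ear = no λ ()
  spine i ⟶? spine j = map′ spine⟶spine (λ { (spine⟶spine eq) → eq }) (toℕ j ≟ suc (toℕ i))

  ⟶-irrefl : ∀ {v} → ¬ (v ⟶ v)
  ⟶-irrefl (hub⟶hub i≢i) = i≢i refl
  ⟶-irrefl (spine⟶spine eq) = 1+n≢n (sym eq)

  _—_ : V → V → Set
  _—_ = SymClosure _⟶_

  _—?_ : Decidable _—_
  v —? w with v ⟶? w | w ⟶? v
  ... | yes v⟶w | _       = yes (fwd v⟶w)
  ... | no _    | yes w⟶v = yes (bwd w⟶v)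
  ... | no ¬v⟶w | no ¬w⟶v = no λ { (fwd v⟶w) → ¬v⟶w v⟶w ; (bwd w⟶v) → ¬w⟶v w⟶v }

  —-sym : ∀ {v w} → v — w → w — v
  —-sym = symmetric _⟶_

  —-irrefl : ∀ {v} → ¬ (v — v)
  —-irrefl (fwd e) = ⟶-irrefl e
  —-irrefl (bwd e) = ⟶-irrefl e

  hub— : ∀ {i w} → w ≢ hub i → hub i — w
  hub— {w = hub j}  w≢ = fwd (hub⟶hub λ { refl → w≢ refl })
  hub— {w = inj₂ w} w≢ = bwd ⟶hub

  ⟦_⟧ : Fin size → V
  ⟦_⟧ = Inverse.to decode

  code : V → Fin size
  code = Inverse.from decode

  ⟦code⟧ : ∀ v → ⟦ code v ⟧ ≡ v
  ⟦code⟧ = Inverse.strictlyInverseˡ decode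

  ⟦⟧-injective : ∀ {i j} → ⟦ i ⟧ ≡ ⟦ j ⟧ → i ≡ j
  ⟦⟧-injective = Injection.injective (↔⇒↣ decode)

  code-injective : ∀ {v w} → code v ≡ code w → v ≡ w
  code-injective = Injection.injective (↔⇒↣ (↔-sym decode))

  graph : Graph size
  graph = record
    { _∼_    = λ i j → ⟦ i ⟧ — ⟦ j ⟧
    ; _∼?_   = λ i j → ⟦ i ⟧ —? ⟦ j ⟧
    ; sym    = —-sym
    ; irrefl = λ { refl → —-irrefl }
    }

  spine≡ : ∀ {i j : Fin (5 + m)} → toℕ i ≡ toℕ j → spine i ≡ (V ∋ spine j)
  spine≡ eq = cong (λ j → spine j) (toℕ-injective eq)

  spine≢ : ∀ {i j : Fin (5 + m)} → toℕ i ≢ toℕ j → spine i ≢ (V ∋ spine j)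
  spine≢ i≢j refl = i≢j refl

  -- In a hole, and in an induced sun, every vertex has two neighbours and a
  -- non-neighbour; no nonempty family W of vertices of the graph is like this.
  module _ {w} (W : V → Set w)
    (neighbours : ∀ {v} → W v → ∃[ a ] ∃[ b ] a ≢ b × (W a × v — a) × (W b × v — b))
    (nonneighbour : ∀ {v} → W v → ∃[ a ] W a × a ≢ v × ¬ (v — a)) where

    private
      ¬unique : ∀ {v} t → W v → (∀ {a} → W a → v — a → a ≡ t) → ⊥
      ¬unique t Wv unique =
        let _ , _ , a≢b , (Wa , va) , (Wb , vb) = neighbours Wv in
        a≢b (trans (unique Wa va) (sym (unique Wb vb)))

      ¬hub : ∀ {i} → ¬ W (hub i)
      ¬hub Wh = let _ , _ , a≢ , ¬e = nonneighbour Wh in ¬e (hub— a≢)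

      ¬solo : ∀ {i} → ¬ W (solo i)
      ¬solo Ws = ¬unique (hub zero) Ws λ { Wa (fwd ⟶hub) → contradiction Wa ¬hub }

      ¬leaf : ∀ {h} → ¬ W (leaf h)
      ¬leaf {h} Wl with neighbours Wl
      ... | hub _ , _ , _ , (Wa , _) , _ = ¬hub Wa
      ... | _ , hub _ , _ , _ , (Wb , _) = ¬hub Wb
      ... | spine i , spine j , i≢j , (_ , fwd (leaf⟶spine i≡)) , (_ , fwd (leaf⟶spine j≡)) =
        i≢j (spine≡ (trans i≡ (sym j≡)))

      -- With hubs, solos and leaves excluded, the apex is adjacent to every other vertex that can
      -- remain, so it has no non-neighbour.
      ¬apex : ¬ W apex
      ¬apex Wx with nonneighbour Wx
      ... | hub _   , Wa , _ , _ = ¬hub Wa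
      ... | solo _  , Wa , _ , _ = ¬solo Wa
      ... | leaf _  , Wa , _ , _ = ¬leaf Wa
      ... | apex    , _ , a≢ , _ = a≢ refl
      ... | ear     , _ , _ , ¬e = ¬e (bwd ear⟶apex)
      ... | spine _ , _ , _ , ¬e = ¬e (bwd spine⟶apex)

      ¬ear : ¬ W ear
      ¬ear We = ¬unique (spine 2F) We λ where
        Wa (fwd ⟶hub)           → contradiction Wa ¬hub
        Wa (fwd ear⟶apex)       → contradiction Wa ¬apex
        Wa (fwd (ear⟶spine eq)) → spine≡ eq

      -- Induction from the lower end of the path: once the predecessor is excluded, the successor
      -- is the only possible neighbour, and one is not enough. The fuel `c` strictly bounds the
      -- index.
      ¬spine : ∀ c j → toℕ j < c → ¬ W (spine j)
      ¬spine (suc c) j j<c Wj with neighbours Wj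
      ... | a , b , a≢b , (Wa , ea) , (Wb , eb) with successor Wa ea | successor Wb eb
        where
        successor : ∀ {a} → W a → spine j — a → ∃[ i ] a ≡ spine i × toℕ i ≡ suc (toℕ j)
        successor Wa (fwd ⟶hub)             = contradiction Wa ¬hub
        successor Wa (fwd spine⟶apex)       = contradiction Wa ¬apex
        successor Wa (fwd (spine⟶spine eq)) = _ , refl , eq
        successor Wa (bwd (leaf⟶spine eq))  = contradiction Wa ¬leaf
        successor Wa (bwd (ear⟶spine eq))   = contradiction Wa ¬ear
        successor Wa (bwd (spine⟶spine eq)) = contradiction Wa
          (¬spine c _ (≤-trans (≤-reflexive (sym eq)) (≤-pred j<c)))
      ... | _ , refl , i≡ | _ , refl , j≡ = a≢b (spine≡ (trans i≡ (sym j≡)))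

    obstruction-free : ∀ {v} → ¬ W v
    obstruction-free {hub _}   = ¬hub
    obstruction-free {solo _}  = ¬solo
    obstruction-free {leaf _}  = ¬leaf
    obstruction-free {apex}    = ¬apex
    obstruction-free {ear}     = ¬ear
    obstruction-free {spine j} = ¬spine _ j ≤-refl

  -- Chordality, absence of suns, connectivity

  chordal : Chordal graph
  chordal (C , 4≤L , induced) =
    obstruction-free (λ v → ∃[ i ] ⟦ vertex i ⟧ ≡ v) neighbours nonneighbour (start , refl)
    where
    open Cycle C using (vertex; injective; adjacent) renaming (length to L; 3≤length to 3≤L)
    start : Fin L
    start = fromℕ< (≤-trans (s≤s z≤n) 3≤L)
    neighbours : ∀ {v} → (∃[ i ] ⟦ vertex i ⟧ ≡ v) → _
    neighbours (i , refl) =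
      ⟦ vertex (next i) ⟧ , ⟦ vertex (prev i) ⟧ ,
      (λ eq → next≢prev 3≤L i (injective (⟦⟧-injective eq))) ,
      ((next i , refl) , adjacent i) ,
      ((prev i , refl) , —-sym (subst (λ j → ⟦ vertex (prev i) ⟧ — ⟦ vertex j ⟧) (next-prev i) (adjacent (prev i))))
    nonneighbour : ∀ {v} → (∃[ i ] ⟦ vertex i ⟧ ≡ v) → _
    nonneighbour (i , refl) =
      ⟦ vertex (next (next i)) ⟧ , (next (next i) , refl) ,
      (λ eq → next²≢ 3≤L i (injective (⟦⟧-injective eq))) ,
      -- The vertex two steps ahead is neither successor nor predecessor of `i`; the latter is where
      -- a length of at least 4 matters.
      λ e → [ next≢ (≤-trans (s≤s (s≤s z≤n)) 3≤L) (next i) , (λ eq → next³≢ 4≤L i (sym eq)) ]′ (induced _ _ e)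

  sun-free : ∀ l → 3 ≤ l → ¬ InducedSun graph l
  sun-free l 3≤l sun =
    obstruction-free W neighbours nonneighbour (inj₁ (fromℕ< (≤-trans (s≤s z≤n) 3≤l) , refl))
    where
    open InducedSun sun
    next≢i : ∀ i → next i ≢ i
    next≢i = next≢ (≤-trans (s≤s (s≤s z≤n)) 3≤l)
    W : V → Set
    W v = (∃[ i ] ⟦ x i ⟧ ≡ v) ⊎ (∃[ i ] ⟦ y i ⟧ ≡ v)
    neighbours : ∀ {v} → W v → _
    neighbours (inj₁ (i , refl)) =
      ⟦ y (next i) ⟧ , ⟦ y i ⟧ ,
      (λ eq → next≢i i (y-injective (⟦⟧-injective eq))) ,
      (inj₂ (next i , refl) , Equivalence.from (x∼y i (next i)) (inj₂ refl)) ,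
      (inj₂ (i , refl) , Equivalence.from (x∼y i i) (inj₁ refl))
    neighbours (inj₂ (i , refl)) =
      ⟦ x i ⟧ , ⟦ y (next i) ⟧ ,
      (λ eq → x≢y i (next i) (⟦⟧-injective eq)) ,
      (inj₁ (i , refl) , —-sym (Equivalence.from (x∼y i i) (inj₁ refl))) ,
      (inj₂ (next i , refl) , y-clique i (next i) (λ eq → next≢i i (sym eq)))
    nonneighbour : ∀ {v} → W v → _
    nonneighbour (inj₁ (i , refl)) =
      ⟦ x (next i) ⟧ , inj₁ (next i , refl) ,
      (λ eq → next≢i i (x-injective (⟦⟧-injective eq))) , x-independent i (next i)
    -- The vertex `x (next i)` sees only the clique vertices one and two steps after `i`, and
    -- neither of these is `y i` because `l` is at least 3.
    nonneighbour (inj₂ (i , refl)) =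
      ⟦ x (next i) ⟧ , inj₁ (next i , refl) ,
      (λ eq → x≢y (next i) i (⟦⟧-injective eq)) ,
      λ e → [ (λ eq → next≢i i (sym eq)) , (λ eq → next²≢ 3≤l i (sym eq)) ]′
        (Equivalence.to (x∼y (next i) i) (—-sym e))

  -- Fewer than `2 + k` deletions spare some hub, and every other surviving vertex is adjacent to
  -- it, so walks of length at most two suffice.
  connected : Connected (2 + k) graph
  connected S ∣S∣<2+k v w v∉S w∉S with any? (λ i → ¬? (code (hub i) ∈? S))
  ... | no none = contradiction ∣S∣<2+k
    (≤⇒≯ (injection⇒≤∣∣ S (λ i → code (hub i)) (λ eq → inj₁-injective (code-injective eq))
      (λ i → decidable-stable (code (hub i) ∈? S) (λ ∉S → none (i , ∉S)))))
  ... | yes (i , h∉S) = to-hub v v∉S ◅◅ from-hub w w∉S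
    where
    h = code (hub i)
    h—others : ∀ u → u ≢ h → ⟦ h ⟧ — ⟦ u ⟧
    h—others u u≢h = subst (_— ⟦ u ⟧) (sym (⟦code⟧ (hub i)))
      (hub— λ eq → u≢h (⟦⟧-injective (trans eq (sym (⟦code⟧ (hub i))))))
    to-hub : ∀ u → u ∉ S → Star _ u h
    to-hub u u∉S with u Fin.≟ h
    ... | yes refl = ε
    ... | no u≢h   = (u∉S , h∉S , —-sym (h—others u u≢h)) ◅ ε
    from-hub : ∀ u → u ∉ S → Star _ h u
    from-hub u u∉S with u Fin.≟ h
    ... | yes refl = ε
    ... | no u≢h   = (h∉S , u∉S , h—others u u≢h) ◅ ε

  -- Landmarks on the spine

  penult⁺ last⁺ : Fin (5 + m)
  penult⁺ = inject₁ (fromℕ (3 + m))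
  last⁺   = fromℕ (4 + m)

  penult≡ : toℕ penult⁺ ≡ 3 + m
  penult≡ = trans (toℕ-inject₁ (fromℕ (3 + m))) (toℕ-fromℕ (3 + m))

  last≡ : toℕ last⁺ ≡ 4 + m
  last≡ = toℕ-fromℕ (4 + m)

  Gap : V → Set
  Gap v = ∃[ j ] v ≡ spine j × 3 ≤ toℕ j × toℕ j ≤ 2 + m

  -- These are the cases for the second neighbour of the apex. The range of `middle` is the gap
  -- together with spine vertex 2.
  data Position : Fin (5 + m) → Set where
    first  : Position 0F
    second : Position 1F
    middle : ∀ {j} → 2 ≤ toℕ j → toℕ j ≤ 2 + m → Position j
    penult : ∀ {j} → toℕ j ≡ 3 + m → Position j
    last   : ∀ {j} → toℕ j ≡ 4 + m → Position j

  position? : ∀ j → Position j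
  position? 0F = first
  position? 1F = second
  position? (suc (suc j)) with toℕ j ≤? m
  ... | yes j≤m = middle (s≤s (s≤s z≤n)) (s≤s (s≤s j≤m))
  ... | no  j≰m with toℕ j ≟ suc m
  ... | yes j≡ = penult (cong (2 +_) j≡)
  ... | no  j≢ = last (cong (2 +_) (≤-antisym (≤-pred (toℕ<n j)) (≤∧≢⇒< (≰⇒> j≰m) (≢-sym j≢))))

  -- Cycles through all leaves and solos

  module CycleNeighbours (C : Cycle graph) where
    open Cycle C using (vertex; injective; adjacent) renaming (length to L; 3≤length to 3≤L)

    at : Fin L → V
    at i = ⟦ vertex i ⟧

    at-injective : ∀ {i j} → at i ≡ at j → i ≡ j
    at-injective eq = injective (⟦⟧-injective eq)

    -- A direction is an element of `Fin 2` so that `opposite` reverses it and so that it can serve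
    -- as a coordinate when the places beside hubs are counted.
    turn : Fin 2 → Fin L → Fin L
    turn 0F = next
    turn 1F = prev

    turn-opposite : ∀ s i → turn (opposite s) (turn s i) ≡ i
    turn-opposite 0F = prev-next
    turn-opposite 1F = next-prev

    turn-injective : ∀ s {i j} → turn s i ≡ turn s j → i ≡ j
    turn-injective s {i} {j} eq =
      trans (sym (turn-opposite s i)) (trans (cong (turn (opposite s)) eq) (turn-opposite s j))

    turn-— : ∀ s i → at i — at (turn s i)
    turn-— 0F i = adjacent i
    turn-— 1F i = —-sym (subst (λ j → at (prev i) — at j) (next-prev i) (adjacent (prev i)))

    sides-distinct : ∀ i → at (turn 0F i) ≢ at (turn 1F i)
    sides-distinct i eq = next≢prev 3≤L i (at-injective eq)

    On : V → Set
    On v = ∃[ i ] at i ≡ v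

    infix 4 _~_
    data _~_ (v w : V) : Set where
      beside : ∀ i s → at i ≡ v → at (turn s i) ≡ w → v ~ w

    ~⇒— : ∀ {v w} → v ~ w → v — w
    ~⇒— (beside i s refl refl) = turn-— s i

    ~-sym : ∀ {v w} → v ~ w → w ~ v
    ~-sym (beside i s refl refl) = beside (turn s i) (opposite s) refl (cong at (turn-opposite s i))

    ~⇒On : ∀ {v w} → v ~ w → On v
    ~⇒On (beside i _ eq _) = i , eq

    two-neighbours : ∀ {v} → On v → ∃[ a ] ∃[ b ] a ≢ b × v ~ a × v ~ b
    two-neighbours (i , refl) =
      at (turn 0F i) , at (turn 1F i) , sides-distinct i , beside i 0F refl refl , beside i 1F refl refl

    -- A vertex has a single position on the cycle, so `a`, `b` and `c` lie in directions `s`, `t`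
    -- and `u` from the same place, and there are only two directions.
    no-third : ∀ {v a b c} → v ~ a → v ~ b → a ≢ b → v ~ c → c ≡ a ⊎ c ≡ b
    no-third (beside i s refl refl) (beside j t j≡ refl) a≢b (beside l u l≡ refl)
      with at-injective j≡ | at-injective l≡
    ... | refl | refl = same s t u a≢b
      where
      same : ∀ s t u → at (turn s i) ≢ at (turn t i) →
        at (turn u i) ≡ at (turn s i) ⊎ at (turn u i) ≡ at (turn t i)
      same 0F 0F _  a≢b = contradiction refl a≢b
      same 1F 1F _  a≢b = contradiction refl a≢b
      same 0F 1F 0F _   = inj₁ refl
      same 0F 1F 1F _   = inj₂ refl
      same 1F 0F 0F _   = inj₂ refl
      same 1F 0F 1F _   = inj₁ refl

    ¬third : ∀ {v a b c} → v ~ a → v ~ b → a ≢ b → c ≢ a → c ≢ b → ¬ (v ~ c)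
    ¬third v~a v~b a≢b c≢a c≢b v~c = [ c≢a , c≢b ]′ (no-third v~a v~b a≢b v~c)

    other-neighbour : ∀ {v a} → v ~ a → ∃[ b ] v ~ b × b ≢ a
    other-neighbour v~a with two-neighbours (~⇒On v~a)
    ... | b , c , b≢c , v~b , v~c with no-third v~b v~c b≢c v~a
    ... | inj₁ refl = c , v~c , ≢-sym b≢c
    ... | inj₂ refl = b , v~b , b≢c

    -- This is the source of the confinement contradictions: a set that the cycle enters and never
    -- leaves contains all its vertices, including one known to lie outside the set.
    closed⇒all : ∀ {p} (P : V → Set p) → (∀ {v w} → P v → v ~ w → P w) →
      ∀ {v w} → P v → On v → On w → P w
    closed⇒all P closed Pv (i , refl) (j , refl) =
      let r , i⊕r≡j = ⊕-reach i j in subst (P ∘ at) i⊕r≡j (walk r)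
      where
      walk : ∀ r → P (at (i ⊕ r))
      walk zero    = Pv
      walk (suc r) = closed (walk r) (beside (i ⊕ r) 0F refl refl)

  -- Counting the places next to hubs

  module Tightness (C : Cycle graph)
    (on-solo : ∀ i → CycleNeighbours.On C (solo i))
    (on-leaf : ∀ h → CycleNeighbours.On C (leaf h)) where

    open CycleNeighbours C
    open Cycle C using () renaming (length to L)

    -- A leaf has only one neighbour besides the hubs.
    leaf-side : ∀ h → ∃[ s ] ∃[ u ] at (turn s (proj₁ (on-leaf h))) ≡ hub u
    leaf-side h with on-leaf h
    ... | i , i≡ = choose (step 0F) (step 1F) refl refl
      where
      step : ∀ s → leaf h — at (turn s i)
      step s = subst (_— at (turn s i)) i≡ (turn-— s i)
      choose : ∀ {v w} → leaf h — v → leaf h — w → at (turn 0F i) ≡ v → at (turn 1F i) ≡ w →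
        ∃[ s ] ∃[ u ] at (turn s i) ≡ hub u
      choose (fwd ⟶hub) _ v≡ _ = 0F , _ , v≡
      choose _ (fwd ⟶hub) _ w≡ = 1F , _ , w≡
      choose (fwd (leaf⟶spine a≡)) (fwd (leaf⟶spine b≡)) v≡ w≡ =
        contradiction (trans v≡ (trans (spine≡ (trans a≡ (sym b≡))) (sym w≡))) (sides-distinct i)

    solo-side : ∀ i s → ∃[ u ] at (turn s (proj₁ (on-solo i))) ≡ hub u
    solo-side i s with on-solo i
    ... | j , j≡ = only-hubs (subst (_— at (turn s j)) j≡ (turn-— s j))
      where
      only-hubs : ∀ {v} → solo i — v → ∃[ u ] v ≡ hub u
      only-hubs (fwd ⟶hub) = _ , refl

    -- A dart is a vertex with a direction in which the cycle is known to meet a hub: both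
    -- directions at a solo, and at a leaf the one chosen by `leaf-side`.
    Dart : Set
    Dart = Fin 4 ⊎ Fin k × Fin 2

    owner : Dart → V
    owner (inj₁ h)       = leaf h
    owner (inj₂ (i , _)) = solo i

    side : Dart → Fin 2
    side (inj₁ h)       = proj₁ (leaf-side h)
    side (inj₂ (_ , s)) = s

    position : Dart → Fin L
    position (inj₁ h)       = proj₁ (on-leaf h)
    position (inj₂ (i , _)) = proj₁ (on-solo i)

    at-position : ∀ d → at (position d) ≡ owner d
    at-position (inj₁ h)       = proj₂ (on-leaf h)
    at-position (inj₂ (i , _)) = proj₂ (on-solo i)

    target : ∀ d → ∃[ u ] at (turn (side d) (position d)) ≡ hub u
    target (inj₁ h)       = proj₂ (leaf-side h)
    target (inj₂ (i , s)) = solo-side i s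

    owner-side-injective : ∀ d e → owner d ≡ owner e → side d ≡ side e → d ≡ e
    owner-side-injective (inj₁ _) (inj₁ _) refl _    = refl
    owner-side-injective (inj₂ _) (inj₂ _) refl refl = refl

    -- There are as many darts as slots, namely 4 + 2k, so an injection of the
    -- darts into the slots leaves no place next to a hub for any other vertex.
    slot : Dart → Fin (2 + k) × Fin 2
    slot d = proj₁ (target d) , side d

    hub-injective : ∀ {i j} → hub i ≡ (V ∋ hub j) → i ≡ j
    hub-injective refl = refl

    position-injective : ∀ d {e u s} → slot d ≡ (u , s) → at (turn s e) ≡ hub u → position d ≡ e
    position-injective d refl eq =
      turn-injective (side d) (at-injective (trans (proj₂ (target d)) (sym eq)))

    -- Stepping back from a hub against a given direction leads to one position only, so a slot
    -- determines the owner of the dart as well as its side.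
    slot-injective : Injective _≡_ _≡_ slot
    slot-injective {d} {e} eq = owner-side-injective d e
      (trans (sym (at-position d)) (trans (cong at (position-injective d eq (proj₂ (target e)))) (at-position e)))
      (cong proj₂ eq)

    slot-surjective : ∀ y → ∃[ d ] slot d ≡ y
    slot-surjective y = ↔-injective⇒surjective
      {n = 4 + k * 2} (↔-trans +↔⊎ (↔-refl ⊎-cong *↔×)) (*↔× {2 + k}) slot-injective y

    -- Every slot is already filled by a dart, so whatever lies next to a hub must be the owner of
    -- that dart.
    beside-hub : ∀ {v i} s {u} → at i ≡ v → at (turn s i) ≡ hub u → ∃[ d ] owner d ≡ v × side d ≡ s
    beside-hub s {u} refl eq =
      let d , d≡ = slot-surjective (u , s) in
      d , trans (sym (at-position d)) (cong at (position-injective d d≡ eq)) , cong proj₂ d≡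

    no-hub : ∀ {v u} → (∀ d → owner d ≢ v) → ¬ (v ~ hub u)
    no-hub ≢v (beside _ s eq eq′) = let d , d≡ , _ = beside-hub s eq eq′ in ≢v d d≡

    -- A hub on the other side of the leaf would require a second dart with the same owner and the
    -- opposite direction, but a leaf owns just one. Its host is then the only choice left.
    leaf~host : ∀ {h j} → toℕ j ≡ host h → leaf h ~ spine j
    leaf~host {h} {j} j≡ = beside i (opposite s) i≡
      (other (subst (_— at (turn (opposite s) i)) i≡ (turn-— (opposite s) i)) refl)
      where
      i = proj₁ (on-leaf h)
      i≡ = proj₂ (on-leaf h)
      s = proj₁ (leaf-side h)
      opposite≢ : ∀ s → s ≢ opposite s
      opposite≢ 0F ()
      opposite≢ 1F ()
      other : ∀ {w} → leaf h — w → at (turn (opposite s) i) ≡ w → at (turn (opposite s) i) ≡ spine j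
      other (fwd (leaf⟶spine w≡)) eq = trans eq (spine≡ (trans w≡ (sym j≡)))
      other (fwd ⟶hub) eq with beside-hub (opposite s) i≡ eq
      ... | inj₁ _ , refl , s≡ = contradiction s≡ (opposite≢ _)

  -- The course of the cycle through spine, apex and ear

  module GapAllOrNothing (C : Cycle graph)
    (on : ∀ {v} → ¬ Gap v → CycleNeighbours.On C v) where

    open CycleNeighbours C

    on-solo : ∀ i → On (solo i)
    on-solo i = on λ ()

    on-leaf : ∀ h → On (leaf h)
    on-leaf h = on λ ()

    open Tightness C on-solo on-leaf

    -- Hubs are absent from this list because a spine vertex owns no dart.
    data SpineNeighbour (j : Fin (5 + m)) : V → Set where
      apexₙ : SpineNeighbour j apex
      earₙ  : toℕ j ≡ 2 → SpineNeighbour j ear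
      leafₙ : ∀ {h} → toℕ j ≡ host h → SpineNeighbour j (leaf h)
      succₙ : ∀ {i} → toℕ i ≡ suc (toℕ j) → SpineNeighbour j (spine i)
      predₙ : ∀ {i} → toℕ j ≡ suc (toℕ i) → SpineNeighbour j (spine i)

    spine-neighbour : ∀ {j w} → spine j ~ w → SpineNeighbour j w
    spine-neighbour j~w with ~⇒— j~w
    ... | fwd ⟶hub             = contradiction j~w (no-hub λ { (inj₁ _) () ; (inj₂ _) () })
    ... | fwd spine⟶apex       = apexₙ
    ... | fwd (spine⟶spine eq) = succₙ eq
    ... | bwd (leaf⟶spine eq)  = leafₙ eq
    ... | bwd (ear⟶spine eq)   = earₙ eq
    ... | bwd (spine⟶spine eq) = predₙ eq

    host~ : ∀ h {j} → toℕ j ≡ host h → spine j ~ leaf h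
    host~ h eq = ~-sym (leaf~host eq)

    inner-host : ∀ (j : Fin (5 + m)) h → 2 ≤ toℕ j → toℕ j ≤ 2 + m → toℕ j ≢ host h
    inner-host _ 0F 2≤ ≤m eq = contradiction (≤-trans 2≤ (≤-reflexive eq)) λ ()
    inner-host _ 1F 2≤ ≤m eq = contradiction (≤-trans 2≤ (≤-reflexive eq)) λ { (s≤s ()) }
    inner-host _ 2F 2≤ ≤m eq = <⇒≱ (≤-reflexive (sym eq)) ≤m
    inner-host _ 3F 2≤ ≤m eq = <⇒≱ (≤-trans (n≤1+n _) (≤-reflexive (sym eq))) ≤m

    -- The ear owns no dart either, and apart from the hubs the graph offers it exactly these two
    -- neighbours.
    ear~apex×ear~2 : ear ~ apex × ear ~ spine 2F
    ear~apex×ear~2 with two-neighbours (on {ear} λ ())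
    ... | a , b , a≢b , ear~a , ear~b = pick (~⇒— ear~a) (~⇒— ear~b) a≢b ear~a ear~b
      where
      ¬ear~hub : ∀ {u} → ¬ (ear ~ hub u)
      ¬ear~hub = no-hub λ { (inj₁ _) () ; (inj₂ _) () }
      pick : ∀ {a b} → ear — a → ear — b → a ≢ b → ear ~ a → ear ~ b → ear ~ apex × ear ~ spine 2F
      pick (fwd ⟶hub) _ _ ~a _ = contradiction ~a ¬ear~hub
      pick _ (fwd ⟶hub) _ _ ~b = contradiction ~b ¬ear~hub
      pick (fwd ear⟶apex) (fwd ear⟶apex) a≢b _ _ = contradiction refl a≢b
      pick (fwd ear⟶apex) (fwd (ear⟶spine eq)) _ ~a ~b = ~a , subst (ear ~_) (spine≡ eq) ~b
      pick (fwd (ear⟶spine eq)) (fwd ear⟶apex) _ ~a ~b = ~b , subst (ear ~_) (spine≡ eq) ~a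
      pick (fwd (ear⟶spine eq)) (fwd (ear⟶spine eq′)) a≢b _ _ =
        contradiction (spine≡ (trans eq (sym eq′))) a≢b

    ear~apex : ear ~ apex
    ear~apex = proj₁ ear~apex×ear~2

    2~ear : spine 2F ~ ear
    2~ear = ~-sym (proj₂ ear~apex×ear~2)

    apex~spine : ∃[ j ] apex ~ spine j
    apex~spine with other-neighbour (~-sym ear~apex)
    ... | w , apex~w , w≢ear with ~⇒— apex~w
    ... | fwd ⟶hub       = contradiction apex~w (no-hub λ { (inj₁ _) () ; (inj₂ _) () })
    ... | bwd ear⟶apex   = contradiction refl w≢ear
    ... | bwd spine⟶apex = _ , apex~w

    module _ {j₀} (apex~j₀ : apex ~ spine j₀) where

      apex-only : ∀ {w} → apex ~ w → w ≡ ear ⊎ w ≡ spine j₀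
      apex-only = no-third (~-sym ear~apex) apex~j₀ λ ()

      spine~apex⇒≡ : ∀ {j} → spine j ~ apex → toℕ j ≡ toℕ j₀
      spine~apex⇒≡ j~apex with apex-only (~-sym j~apex)
      ... | inj₂ refl = refl

      -- The apex is used up by the ear and `spine j₀`, so besides its leaf the first spine vertex
      -- has only its successor left. The same argument at the other end gives `last~`.
      first~ : toℕ j₀ ≢ 0 → spine 0F ~ spine 1F
      first~ j₀≢ with other-neighbour (host~ 0F refl)
      ... | w , ~w , w≢ with spine-neighbour ~w
      ... | apexₙ            = contradiction (sym (spine~apex⇒≡ ~w)) j₀≢
      ... | leafₙ {0F} _     = contradiction refl w≢
      ... | leafₙ {1F} ()
      ... | leafₙ {2F} ()
      ... | leafₙ {3F} ()
      ... | succₙ eq         = subst (spine 0F ~_) (spine≡ eq) ~w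

      last~ : toℕ j₀ ≢ 4 + m → spine last⁺ ~ spine penult⁺
      last~ j₀≢ with other-neighbour (host~ 3F last≡)
      ... | w , ~w , w≢ with spine-neighbour ~w
      ... | apexₙ            = contradiction (trans (sym (spine~apex⇒≡ ~w)) last≡) j₀≢
      ... | earₙ eq          = contradiction (trans (sym last≡) eq) λ ()
      ... | leafₙ {0F} eq    = contradiction (trans (sym last≡) eq) λ ()
      ... | leafₙ {1F} eq    = contradiction (trans (sym last≡) eq) λ ()
      ... | leafₙ {2F} eq    = contradiction (trans (sym last≡) eq) 1+n≢n
      ... | leafₙ {3F} _     = contradiction refl w≢
      ... | succₙ {i} eq     = contradiction (toℕ<n i) (≤⇒≯ (≤-reflexive (sym (trans eq (cong suc last≡)))))
      ... | predₙ eq         =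
        subst (spine last⁺ ~_) (spine≡ (trans (suc-injective (trans (sym eq) last≡)) (sym penult≡))) ~w

    -- The penultimate vertex is used up by its leaf and the last vertex; this seals the upper end
    -- of the gap.
    ¬penult~ : spine last⁺ ~ spine penult⁺ → ∀ {j} → toℕ j ≤ 2 + m → ¬ (spine penult⁺ ~ spine j)
    ¬penult~ l~p j≤ = ¬third (host~ 2F penult≡) (~-sym l~p) (λ ()) (λ ())
      (spine≢ λ eq → <⇒≱ (≤-trans (n≤1+n _) (≤-reflexive (sym (trans eq last≡)))) j≤)

    -- Here vertex 2 is used up by the ear and vertex 1, and the penultimate vertex by its leaf and
    -- the last vertex. No step of the cycle leaves the gap, so a visited gap vertex would keep the
    -- cycle from the ear. With no gap vertex visited this case does occur, namely in the short
    -- cycle.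
    ¬apex~first : ∀ {v} → Gap v → On v → ¬ (apex ~ spine 0F)
    ¬apex~first Gv on-v apex~0 = ¬gap-ear (closed⇒all Gap closed Gv on-v (on {ear} λ ()))
      where
      ¬gap-ear : ¬ Gap ear
      ¬gap-ear ()
      last~penult = last~ apex~0 λ ()
      -- Vertex 0 is used up by its leaf and the apex, and the apex by vertex 0 and the ear, so
      -- vertex 1 must turn to vertex 2.
      1~2 : spine 1F ~ spine 2F
      1~2 with other-neighbour (host~ 1F refl)
      ... | w , ~w , w≢ with spine-neighbour ~w
      ... | apexₙ        = contradiction (spine~apex⇒≡ apex~0 ~w) λ ()
      ... | leafₙ {1F} _ = contradiction refl w≢
      ... | leafₙ {2F} ()
      ... | leafₙ {3F} ()
      ... | succₙ eq     = subst (spine 1F ~_) (spine≡ eq) ~w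
      ... | predₙ {0F} _ = contradiction (~-sym ~w)
        (¬third (host~ 0F refl) (~-sym apex~0) (λ ()) (λ ()) (λ ()))
      closed : ∀ {v w} → Gap v → v ~ w → Gap w
      closed (j , refl , 3≤j , j≤) j~w with spine-neighbour j~w
      ... | apexₙ = contradiction (≤-trans 3≤j (≤-reflexive (spine~apex⇒≡ apex~0 j~w))) λ ()
      ... | earₙ eq = contradiction (≤-trans 3≤j (≤-reflexive eq)) λ { (s≤s (s≤s ())) }
      ... | leafₙ {h} eq = contradiction eq (inner-host j h (≤-trans (n≤1+n 2) 3≤j) j≤)
      ... | succₙ {i} eq with toℕ i ≤? 2 + m
      ...   | yes i≤ = i , refl , ≤-trans 3≤j (≤-trans (n≤1+n _) (≤-reflexive (sym eq))) , i≤
      ...   | no  i≰ = contradiction (~-sym (subst (spine j ~_) (spine≡ i≡) j~w)) (¬penult~ last~penult j≤)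
        where
        i≡ : toℕ i ≡ toℕ penult⁺
        i≡ = trans (≤-antisym (≤-trans (≤-reflexive eq) (s≤s j≤)) (≰⇒> i≰)) (sym penult≡)
      closed (j , refl , 3≤j , j≤) j~w | predₙ {i} eq with 3 ≤? toℕ i
      ...   | yes 3≤i = i , refl , 3≤i , ≤-trans (n≤1+n _) (≤-trans (≤-reflexive (sym eq)) j≤)
      ...   | no  3≰i = contradiction (~-sym (subst (spine j ~_) (spine≡ i≡2) j~w))
        (¬third 2~ear (~-sym 1~2) (λ ()) (λ ())
          (spine≢ λ eq → <⇒≱ (≤-trans (s≤s (s≤s z≤n)) 3≤j) (≤-reflexive eq)))
        where
        i≡2 : toℕ i ≡ 2
        i≡2 = ≤-antisym (≤-pred (≰⇒> 3≰i)) (≤-pred (≤-trans 3≤j (≤-reflexive eq)))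

    -- Vertex 1 would have three neighbours on the cycle: its leaf, the apex, and vertex 0 by
    -- `first~`. The mirror image is `¬apex~penult`.
    ¬apex~second : ¬ (apex ~ spine 1F)
    ¬apex~second apex~1 =
      ¬third (host~ 1F refl) (~-sym apex~1) (λ ()) (λ ()) (λ ()) (~-sym (first~ apex~1 λ ()))

    ¬apex~penult : ¬ (apex ~ spine penult⁺)
    ¬apex~penult apex~p = ¬third (host~ 2F penult≡) (~-sym apex~p) (λ ()) (λ ()) (λ ())
      (~-sym (last~ apex~p λ eq → 1+n≢n (trans (sym eq) penult≡)))

    -- Both ends of the spine close up: vertex 1 is used up by its leaf and vertex 0, the
    -- penultimate vertex by its leaf and the last one. The cycle can then never leave the set of
    -- apex, ear and the spine vertices in between, although it has to visit the leaves.
    ¬apex~middle : ∀ {j} → 2 ≤ toℕ j → toℕ j ≤ 2 + m → ¬ (apex ~ spine j)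
    ¬apex~middle {j₀} 2≤j₀ j₀≤ apex~j₀ = ¬inside-leaf (closed⇒all Inside closed {ear} _ (on λ ()) (on-leaf 0F))
      where
      Inside : V → Set
      Inside apex      = ⊤
      Inside ear       = ⊤
      Inside (spine j) = 2 ≤ toℕ j × toℕ j ≤ 2 + m
      Inside _         = ⊥
      ¬inside-leaf : ¬ Inside (leaf 0F)
      ¬inside-leaf ()
      0~1 = first~ apex~j₀ λ eq → contradiction (≤-trans 2≤j₀ (≤-reflexive eq)) λ ()
      last~penult = last~ apex~j₀ λ eq → <⇒≱ (≤-trans (n≤1+n _) (≤-reflexive (sym eq))) j₀≤
      closed : ∀ {v w} → Inside v → v ~ w → Inside w
      closed {apex} _ ~w with apex-only apex~j₀ ~w
      ... | inj₁ refl = _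
      ... | inj₂ refl = 2≤j₀ , j₀≤
      closed {ear} _ ~w with no-third ear~apex (~-sym 2~ear) (λ ()) ~w
      ... | inj₁ refl = _
      ... | inj₂ refl = ≤-refl , s≤s (s≤s z≤n)
      closed {spine j} (2≤j , j≤) ~w with spine-neighbour ~w
      ... | apexₙ = _
      ... | earₙ _ = _
      ... | leafₙ {h} eq = contradiction eq (inner-host j h 2≤j j≤)
      ... | succₙ {i} eq with toℕ i ≤? 2 + m
      ...   | yes i≤ = ≤-trans 2≤j (≤-trans (n≤1+n _) (≤-reflexive (sym eq))) , i≤
      ...   | no  i≰ = contradiction (~-sym (subst (spine j ~_) (spine≡ i≡) ~w)) (¬penult~ last~penult j≤)
        where
        i≡ : toℕ i ≡ toℕ penult⁺
        i≡ = trans (≤-antisym (≤-trans (≤-reflexive eq) (s≤s j≤)) (≰⇒> i≰)) (sym penult≡)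
      closed {spine j} (2≤j , j≤) ~w | predₙ {i} eq with 2 ≤? toℕ i
      ...   | yes 2≤i = 2≤i , ≤-trans (n≤1+n _) (≤-trans (≤-reflexive (sym eq)) j≤)
      ...   | no  2≰i = contradiction (~-sym (subst (spine j ~_) (spine≡ i≡1) ~w))
        (¬third (host~ 1F refl) (~-sym 0~1) (λ ()) (λ ()) (spine≢ λ eq → <⇒≱ 2≤j (≤-trans (≤-reflexive eq) z≤n)))
        where
        i≡1 : toℕ i ≡ 1
        i≡1 = ≤-antisym (≤-pred (≰⇒> 2≰i)) (≤-pred (≤-trans 2≤j (≤-reflexive eq)))

    module _ (apex~last : apex ~ spine last⁺) where

      ≢last : ∀ (j : Fin (5 + m)) → toℕ j ≤ 3 + m → toℕ j ≢ toℕ last⁺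
      ≢last _ j≤ eq = <⇒≱ (≤-reflexive (sym (trans eq last≡))) j≤

      -- The cycle is forced down the spine, one edge at a time, from the penultimate vertex; `c` is
      -- the distance of `j` from the upper end `2 + m` of the gap.
      descend : ∀ c j → c + toℕ j ≡ 2 + m → 2 ≤ toℕ j → ∃[ i ] toℕ i ≡ suc (toℕ j) × spine i ~ spine j
      descend zero j j≡ 2≤j with other-neighbour (host~ 2F penult≡)
      ... | w , ~w , w≢ with spine-neighbour ~w
      ... | apexₙ         = contradiction (spine~apex⇒≡ apex~last ~w) (≢last penult⁺ (≤-reflexive penult≡))
      ... | earₙ eq       = contradiction (trans (sym penult≡) eq) λ ()
      ... | leafₙ {0F} eq = contradiction (trans (sym penult≡) eq) λ ()
      ... | leafₙ {1F} eq = contradiction (trans (sym penult≡) eq) λ ()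
      ... | leafₙ {2F} _  = contradiction refl w≢
      ... | leafₙ {3F} eq = contradiction (trans (sym eq) penult≡) 1+n≢n
      ... | predₙ eq      =
        penult⁺ , trans penult≡ (cong suc (sym j≡)) ,
        subst (spine penult⁺ ~_) (spine≡ (trans (suc-injective (trans (sym eq) penult≡)) (sym j≡))) ~w
      -- The last spine vertex is used up by its leaf and the apex.
      ... | succₙ eq      = contradiction
        (~-sym (subst (spine penult⁺ ~_) (spine≡ (trans eq (trans (cong suc penult≡) (sym last≡)))) ~w))
        (¬third (host~ 3F last≡) (~-sym apex~last) (λ ()) (λ ()) (λ ()))
      descend (suc c) j eq 2≤j = j⁺ , j⁺≡ , j⁺~j
        where
        j< : suc (toℕ j) ≤ 2 + m
        j< = ≤-trans (s≤s (m≤n+m (toℕ j) c)) (≤-reflexive eq)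
        j⁺ : Fin (5 + m)
        j⁺ = fromℕ< (s≤s (≤-trans j< (m≤n+m (2 + m) 2)))
        j⁺≡ : toℕ j⁺ ≡ suc (toℕ j)
        j⁺≡ = toℕ-fromℕ< (s≤s (≤-trans j< (m≤n+m (2 + m) 2)))
        -- This keeps `j⁺` above vertex 2, the only place where the path could turn off to the ear.
        3≤j⁺ : 3 ≤ toℕ j⁺
        3≤j⁺ = ≤-trans (s≤s 2≤j) (≤-reflexive (sym j⁺≡))
        j⁺≤ : toℕ j⁺ ≤ 2 + m
        j⁺≤ = ≤-trans (≤-reflexive j⁺≡) j<
        j⁺~j : spine j⁺ ~ spine j
        j⁺~j with descend c j⁺ (trans (cong (c +_) j⁺≡) (trans (+-suc c _) eq)) (≤-trans (n≤1+n 2) 3≤j⁺)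
        ... | i , i≡ , i~j⁺ with other-neighbour (~-sym i~j⁺)
        ... | w , ~w , w≢ with spine-neighbour ~w
        ... | apexₙ    = contradiction (spine~apex⇒≡ apex~last ~w) (≢last j⁺ (≤-trans j⁺≤ (n≤1+n _)))
        ... | earₙ eq′ = contradiction (≤-trans 3≤j⁺ (≤-reflexive eq′)) λ { (s≤s (s≤s ())) }
        ... | leafₙ {h} eq′ = contradiction eq′ (inner-host j⁺ h (≤-trans (n≤1+n 2) 3≤j⁺) j⁺≤)
        ... | succₙ eq′ = contradiction (spine≡ (trans eq′ (sym i≡))) w≢
        ... | predₙ eq′ = subst (spine j⁺ ~_) (spine≡ (suc-injective (trans (sym eq′) j⁺≡))) ~w

    -- The visited gap vertex rules out `first`, three further positions are impossible, and for
    -- `last` the descent gives every gap vertex a neighbour on the cycle.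
    one⇒all : ∀ {v} → Gap v → On v → ∀ {w} → Gap w → On w
    one⇒all Gv on-v {w} (j , refl , 3≤j , j≤) with apex~spine
    ... | j₀ , apex~j₀ with position? j₀
    ... | first         = contradiction apex~j₀ (¬apex~first Gv on-v)
    ... | second        = contradiction apex~j₀ ¬apex~second
    ... | middle 2≤ ≤2+m = contradiction apex~j₀ (¬apex~middle 2≤ ≤2+m)
    ... | penult eq     =
      contradiction (subst (apex ~_) (spine≡ (trans eq (sym penult≡))) apex~j₀) ¬apex~penult
    ... | last eq       =
      ~⇒On (~-sym (proj₂ (proj₂ (descend (subst (apex ~_) (spine≡ (trans eq (sym last≡))) apex~j₀)
        (2 + m ∸ toℕ j) j (m∸n+n≡m j≤) (≤-trans (n≤1+n 2) 3≤j)))))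

  -- Cycles given as lists

  infix 4 _≺[_]_
  -- Adjacency and growth of a rank are combined so that one chain through a list shows both that it
  -- is a walk and that its vertices are distinct.
  _≺[_]_ : V → (V → ℕ) → V → Set
  v ≺[ rank ] w = v — w × rank v < rank w

  alternate : ∀ {j} → (Fin j → V) → (Fin j → V) → List V
  alternate {zero}  g h = []
  alternate {suc j} g h = g zero ∷ h zero ∷ alternate (g ∘ suc) (h ∘ suc)

  alternate-linked : ∀ {r} {R : V → V → Set r} {j} (g h : Fin j → V) {v} → (∀ i → R v (g i)) →
    (∀ i → R (g i) (h i)) → (∀ i i′ → i Fin.< i′ → R (h i) (g i′)) → Linked R (v ∷ alternate g h)
  alternate-linked {j = zero}  g h v≺g g≺h h≺g = [-]
  alternate-linked {j = suc j} g h v≺g g≺h h≺g =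
    v≺g zero ∷ g≺h zero ∷ alternate-linked (g ∘ suc) (h ∘ suc)
      (λ i → h≺g zero (suc i) z<s) (g≺h ∘ suc) (λ i i′ i<i′ → h≺g (suc i) (suc i′) (s<s i<i′))

  ∈-alternateˡ : ∀ {j} (g h : Fin j → V) i → g i ∈ˡ alternate g h
  ∈-alternateˡ g h zero    = here refl
  ∈-alternateˡ g h (suc i) = there (there (∈-alternateˡ (g ∘ suc) (h ∘ suc) i))

  ∈-alternateʳ : ∀ {j} (g h : Fin j → V) i → h i ∈ˡ alternate g h
  ∈-alternateʳ g h zero    = there (here refl)
  ∈-alternateʳ g h (suc i) = there (there (∈-alternateʳ (g ∘ suc) (h ∘ suc) i))

  All-alternate : ∀ {p} {P : V → Set p} {j} (g h : Fin j → V) → (∀ i → P (g i)) → (∀ i → P (h i)) →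
    All P (alternate g h)
  All-alternate {j = zero}  g h Pg Ph = []
  All-alternate {j = suc j} g h Pg Ph = Pg zero ∷ Ph zero ∷ All-alternate (g ∘ suc) (h ∘ suc) (Pg ∘ suc) (Ph ∘ suc)

  -- Hubs 0 and 1 serve the leaves in both cycles below; the other `k` hubs take up the `k` solos.
  rounds : List V
  rounds = alternate (λ i → hub (suc (suc i))) solo

  rounds-linked : ∀ (rank : V → ℕ) c → (∀ i → rank (hub (suc (suc i))) ≡ c + 2 * toℕ i) →
    (∀ i → rank (solo i) ≡ suc c + 2 * toℕ i) →
    ∀ {v} → (∀ i → v ≢ hub i) → rank v < c → Linked _≺[ rank ]_ (v ∷ rounds)
  rounds-linked rank c rank-hub rank-solo {v} v≢hub v<c = alternate-linked _ _
    (λ i → —-sym (hub— (v≢hub _)) , (begin-strict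
      rank v              <⟨ v<c ⟩
      c                   ≤⟨ m≤m+n c _ ⟩
      c + 2 * toℕ i       ≡⟨ rank-hub i ⟨
      rank (hub (suc (suc i))) ∎))
    (λ i → hub— (λ ()) , (begin-strict
      rank (hub (suc (suc i))) ≡⟨ rank-hub i ⟩
      c + 2 * toℕ i       <⟨ ≤-refl ⟩
      suc c + 2 * toℕ i   ≡⟨ rank-solo i ⟨
      rank (solo i)       ∎))
    (λ i i′ i<i′ → fwd ⟶hub , (begin-strict
      rank (solo i)       ≡⟨ rank-solo i ⟩
      suc c + 2 * toℕ i   <⟨ ≤-refl ⟩
      2 + c + 2 * toℕ i   ≡⟨ cong (_+ 2 * toℕ i) (+-comm 2 c) ⟩
      c + 2 + 2 * toℕ i   ≡⟨ +-assoc c 2 _ ⟩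
      c + (2 + 2 * toℕ i) ≡⟨ cong (c +_) (*-suc 2 (toℕ i)) ⟨
      c + 2 * suc (toℕ i) ≤⟨ +-monoʳ-≤ c (*-monoʳ-≤ 2 i<i′) ⟩
      c + 2 * toℕ i′      ≡⟨ rank-hub i′ ⟨
      rank (hub (suc (suc i′))) ∎))
    where open ≤-Reasoning

  module _ {rank : V → ℕ} {vs : List V} (linked : Linked _≺[ rank ]_ (hub zero ∷ vs)) (2≤ : 2 ≤ length vs) where

    private
      xs = hub zero ∷ vs

      lookup-injective : Injective _≡_ _≡_ (lookup xs)
      lookup-injective = ranked⇒lookup-injective rank (Linked.map proj₂ linked)

    -- Since the list starts with a hub, the closing edge comes for free: the hub is adjacent to
    -- whatever the last entry is.
    listCycle : Cycle graph
    listCycle = record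
      { length    = length xs
      ; 3≤length  = s≤s 2≤
      ; vertex    = code ∘ lookup xs
      ; injective = λ eq → lookup-injective (code-injective eq)
      ; adjacent  = λ i → subst₂ _—_ (sym (⟦code⟧ _)) (sym (⟦code⟧ _)) (step i)
      }
      where
      step : ∀ i → lookup xs i — lookup xs (next i)
      step i with next-cases i
      ... | inj₁ eq = Linked-lookup (Linked.map proj₁ linked) i (next i) eq
      ... | inj₂ eq = subst (λ j → lookup xs i — lookup xs j) (sym next≡)
        (—-sym (hub— λ i≡ → next≢ (s≤s (≤-trans (s≤s z≤n) 2≤)) i (trans next≡ (sym (lookup-injective i≡)))))
        where
        next≡ : next i ≡ zero
        next≡ = toℕ-injective eq

    ∈-listCycle⁺ : ∀ {v} → v ∈ˡ xs → code v ∈ vertices listCycle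
    ∈-listCycle⁺ v∈ = subst (λ w → code w ∈ vertices listCycle) (sym (lookup-index v∈))
      (∈-vertices⁺ listCycle (index v∈))

    ∈-listCycle⁻ : ∀ {v} → v ∈ vertices listCycle → ⟦ v ⟧ ∈ˡ xs
    ∈-listCycle⁻ v∈ with ∈-vertices⁻ listCycle v∈
    ... | i , refl = subst (_∈ˡ xs) (sym (⟦code⟧ _)) (∈-lookup i)

  -- The short cycle and the Hamiltonian cycle

  last—penult : spine last⁺ — spine penult⁺
  last—penult = bwd (spine⟶spine (trans last≡ (cong suc (sym penult≡))))

  -- Spine vertices 2 to `3 + m`, that is, the gap with one more vertex at each end. The form with
  -- `inject₁` is the one that `view` recognises in `longRank`.
  run : Fin (2 + m) → V
  run i = spine (inject₁ (suc (suc i)))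

  -- The second neighbour of the apex is vertex 0 in the short cycle and the last spine vertex in
  -- the long one, matching the two positions `first` and `last`.
  shortTail longTail : List V
  shortTail =
    leaf 1F ∷ spine 1F ∷ spine 2F ∷ ear ∷ apex ∷ spine 0F ∷ leaf 0F ∷
    hub 1F ∷ leaf 2F ∷ spine penult⁺ ∷ spine last⁺ ∷ leaf 3F ∷ rounds
  longTail =
    leaf 1F ∷ spine 1F ∷ spine 0F ∷ leaf 0F ∷
    hub 1F ∷ leaf 3F ∷ spine last⁺ ∷ apex ∷ ear ∷
    (tabulate run ++ leaf 2F ∷ rounds)

  -- Ranks are positions in the list, except that `shortRank` reserves 10 to `9 + m` for the gap
  -- vertices, which the short cycle omits.
  shortRank longRank : V → ℕ
  shortRank (hub 0F)                    = 0
  shortRank (leaf 1F)                   = 1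
  shortRank (spine 1F)                  = 2
  shortRank (spine 2F)                  = 3
  shortRank ear                         = 4
  shortRank apex                        = 5
  shortRank (spine 0F)                  = 6
  shortRank (leaf 0F)                   = 7
  shortRank (hub 1F)                    = 8
  shortRank (leaf 2F)                   = 9
  shortRank (spine (suc (suc (suc j)))) = 10 + toℕ j
  shortRank (leaf 3F)                   = 12 + m
  shortRank (hub (suc (suc i)))         = 13 + m + 2 * toℕ i
  shortRank (solo i)                    = 14 + m + 2 * toℕ i

  longRank (hub 0F)              = 0
  longRank (leaf 1F)             = 1
  longRank (spine 1F)            = 2
  longRank (spine 0F)            = 3
  longRank (leaf 0F)             = 4
  longRank (hub 1F)              = 5
  longRank (leaf 3F)             = 6
  longRank (spine (suc (suc j))) with view j
  ... | ‵fromℕ                   = 7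
  ... | ‵inject₁ i               = 10 + toℕ i
  longRank apex                  = 8
  longRank ear                   = 9
  longRank (leaf 2F)             = 12 + m
  longRank (hub (suc (suc i)))   = 13 + m + 2 * toℕ i
  longRank (solo i)              = 14 + m + 2 * toℕ i

  longRank-last : longRank (spine last⁺) ≡ 7
  longRank-last rewrite view-fromℕ (2 + m) = refl

  longRank-run : ∀ i → longRank (run i) ≡ 10 + toℕ i
  longRank-run i rewrite view-inject₁ i = refl

  short-linked : Linked _≺[ shortRank ]_ (hub zero ∷ shortTail)
  short-linked =
    (bwd ⟶hub , <ᵇ⇒< 0 1 _) ∷
    (fwd (leaf⟶spine refl) , <ᵇ⇒< 1 2 _) ∷
    (fwd (spine⟶spine refl) , <ᵇ⇒< 2 3 _) ∷
    (bwd (ear⟶spine refl) , <ᵇ⇒< 3 4 _) ∷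
    (fwd ear⟶apex , <ᵇ⇒< 4 5 _) ∷
    (bwd spine⟶apex , <ᵇ⇒< 5 6 _) ∷
    (bwd (leaf⟶spine refl) , <ᵇ⇒< 6 7 _) ∷
    (fwd ⟶hub , <ᵇ⇒< 7 8 _) ∷
    (bwd ⟶hub , <ᵇ⇒< 8 9 _) ∷
    (fwd (leaf⟶spine penult≡) , m≤m+n 10 _) ∷
    (—-sym last—penult , +-monoʳ-< 10 (≤-reflexive (trans (cong suc (trans (toℕ-inject₁ (fromℕ m)) (toℕ-fromℕ m))) (sym (toℕ-fromℕ (1 + m)))))) ∷
    (bwd (leaf⟶spine last≡) , +-monoʳ-< 10 (s≤s (≤-reflexive (toℕ-fromℕ (1 + m))))) ∷
    rounds-linked shortRank (13 + m) (λ _ → refl) (λ _ → refl) (λ _ ()) ≤-refl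

  long-linked : Linked _≺[ longRank ]_ (hub zero ∷ longTail)
  long-linked =
    (bwd ⟶hub , <ᵇ⇒< 0 1 _) ∷
    (fwd (leaf⟶spine refl) , <ᵇ⇒< 1 2 _) ∷
    (bwd (spine⟶spine refl) , <ᵇ⇒< 2 3 _) ∷
    (bwd (leaf⟶spine refl) , <ᵇ⇒< 3 4 _) ∷
    (fwd ⟶hub , <ᵇ⇒< 4 5 _) ∷
    (bwd ⟶hub , <ᵇ⇒< 5 6 _) ∷
    (fwd (leaf⟶spine last≡) , ≤-reflexive (sym longRank-last)) ∷
    (fwd spine⟶apex , s≤s (≤-reflexive longRank-last)) ∷
    (bwd ear⟶apex , <ᵇ⇒< 8 9 _) ∷
    (fwd (ear⟶spine refl) , ≤-trans (m≤m+n 10 _) (≤-reflexive (sym (longRank-run zero)))) ∷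
    tabulate-linked run
      (λ i → fwd (spine⟶spine (trans (toℕ-inject₁ (suc (suc (suc i)))) (cong (3 +_) (sym (trans (toℕ-inject₁ (inject₁ i)) (toℕ-inject₁ i)))))) ,
        subst₂ _<_ (sym (longRank-run (inject₁ i))) (sym (longRank-run (suc i)))
          (+-monoʳ-< 10 (s≤s (≤-reflexive (toℕ-inject₁ i)))))
      ((bwd (leaf⟶spine penult≡) ,
        subst (_< 12 + m) (sym (longRank-run (fromℕ (1 + m)))) (+-monoʳ-< 10 (s≤s (≤-reflexive (toℕ-fromℕ (1 + m)))))) ∷
      rounds-linked longRank (13 + m) (λ _ → refl) (λ _ → refl) (λ _ ()) ≤-refl)

  long-covers : ∀ v → v ∈ˡ hub zero ∷ longTail
  long-covers (hub 0F)            = here refl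
  long-covers (leaf 1F)           = there (here refl)
  long-covers (spine 1F)          = there (there (here refl))
  long-covers (spine 0F)          = there (there (there (here refl)))
  long-covers (leaf 0F)           = there (there (there (there (here refl))))
  long-covers (hub 1F)            = there (there (there (there (there (here refl)))))
  long-covers (leaf 3F)           = there (there (there (there (there (there (here refl))))))
  long-covers (spine (suc (suc j))) with view j
  ... | ‵fromℕ                    = there (there (there (there (there (there (there (here refl)))))))
  ... | ‵inject₁ i                =
    ∈-++⁺ʳ (_ ∷ _ ∷ _ ∷ _ ∷ _ ∷ _ ∷ _ ∷ _ ∷ _ ∷ _ ∷ []) (∈-++⁺ˡ (∈-tabulate⁺ {f = run} i))
  long-covers apex                = there (there (there (there (there (there (there (there (here refl))))))))
  long-covers ear                 = there (there (there (there (there (there (there (there (there (here refl)))))))))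
  long-covers (leaf 2F)           = there (there (there (there (there (there (there (there (there (there
    (∈-++⁺ʳ (tabulate run) (here refl)))))))))))
  long-covers (hub (suc (suc i))) = there (there (there (there (there (there (there (there (there (there
    (∈-++⁺ʳ (tabulate run) (there (∈-alternateˡ _ solo i))))))))))))
  long-covers (solo i)            = there (there (there (there (there (there (there (there (there (there
    (∈-++⁺ʳ (tabulate run) (there (∈-alternateʳ _ solo i))))))))))))

  short-covers : ∀ v → ¬ Gap v → v ∈ˡ hub zero ∷ shortTail
  short-covers (hub 0F)  _ = here refl
  short-covers (leaf 1F) _ = there (here refl)
  short-covers ear       _ = there (there (there (there (here refl))))
  short-covers apex      _ = there (there (there (there (there (here refl)))))
  short-covers (leaf 0F) _ = there (there (there (there (there (there (there (here refl)))))))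
  short-covers (hub 1F)  _ = there (there (there (there (there (there (there (there (here refl))))))))
  short-covers (leaf 2F) _ = there (there (there (there (there (there (there (there (there (here refl)))))))))
  short-covers (leaf 3F) _ =
    ∈-++⁺ʳ (_ ∷ _ ∷ _ ∷ _ ∷ _ ∷ _ ∷ _ ∷ _ ∷ _ ∷ _ ∷ _ ∷ _ ∷ []) (here refl)
  short-covers (hub (suc (suc i))) _ =
    ∈-++⁺ʳ (_ ∷ _ ∷ _ ∷ _ ∷ _ ∷ _ ∷ _ ∷ _ ∷ _ ∷ _ ∷ _ ∷ _ ∷ _ ∷ []) (∈-alternateˡ _ solo i)
  short-covers (solo i) _ =
    ∈-++⁺ʳ (_ ∷ _ ∷ _ ∷ _ ∷ _ ∷ _ ∷ _ ∷ _ ∷ _ ∷ _ ∷ _ ∷ _ ∷ _ ∷ []) (∈-alternateʳ _ solo i)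
  short-covers (spine j) ¬gap with position? j
  ... | first     = there (there (there (there (there (there (here refl))))))
  ... | second    = there (there (here refl))
  ... | penult eq =
    ∈-++⁺ʳ (_ ∷ _ ∷ _ ∷ _ ∷ _ ∷ _ ∷ _ ∷ _ ∷ _ ∷ _ ∷ []) (here (spine≡ (trans eq (sym penult≡))))
  ... | last eq   =
    ∈-++⁺ʳ (_ ∷ _ ∷ _ ∷ _ ∷ _ ∷ _ ∷ _ ∷ _ ∷ _ ∷ _ ∷ _ ∷ []) (here (spine≡ (trans eq (sym last≡))))
  ... | middle 2≤j j≤ with toℕ j ≟ 2
  ...   | yes j≡2 = there (there (there (here (spine≡ j≡2))))
  ...   | no  j≢2 = contradiction (j , refl , ≤∧≢⇒< 2≤j (≢-sym j≢2) , j≤) ¬gap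

  short-avoids : All (¬_ ∘ Gap) (hub zero ∷ shortTail)
  short-avoids =
    (λ ()) ∷ (λ ()) ∷ (λ { (_ , refl , s≤s () , _) }) ∷ (λ { (_ , refl , s≤s (s≤s ()) , _) }) ∷ (λ ()) ∷ (λ ()) ∷
    (λ { (_ , refl , () , _) }) ∷ (λ ()) ∷ (λ ()) ∷ (λ ()) ∷
    (λ { (_ , refl , _ , ≤2+m) → <⇒≱ (≤-reflexive (sym penult≡)) ≤2+m }) ∷
    (λ { (_ , refl , _ , ≤2+m) → <⇒≱ (≤-trans (n≤1+n _) (≤-reflexive (sym last≡))) ≤2+m }) ∷ (λ ()) ∷
    All-alternate _ _ (λ _ ()) (λ _ ())

  hamiltonian : Hamiltonian graph
  hamiltonian = listCycle long-linked (s≤s (s≤s z≤n)) , λ v →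
    subst (_∈ vertices (listCycle long-linked (s≤s (s≤s z≤n)))) (Inverse.strictlyInverseʳ decode v)
      (∈-listCycle⁺ long-linked (s≤s (s≤s z≤n)) (long-covers ⟦ v ⟧))

  shortCycle : Cycle graph
  shortCycle = listCycle short-linked (s≤s (s≤s z≤n))

  ¬gap⇒∈short : ∀ {v} → ¬ Gap v → code v ∈ vertices shortCycle
  ¬gap⇒∈short ¬Gv = ∈-listCycle⁺ short-linked (s≤s (s≤s z≤n)) (short-covers _ ¬Gv)

  gap⇒∉short : ∀ {v} → Gap v → code v ∉ vertices shortCycle
  gap⇒∉short Gv v∈ = All.lookup short-avoids
    (∈-listCycle⁻ short-linked (s≤s (s≤s z≤n)) v∈) (subst Gap (sym (⟦code⟧ _)) Gv)

  -- The short cycle is not extendable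

  gap? : ∀ v → Dec (Gap v)
  gap? (hub _)   = no λ ()
  gap? (solo _)  = no λ ()
  gap? (leaf _)  = no λ ()
  gap? apex      = no λ ()
  gap? ear       = no λ ()
  gap? (spine j) = map′ (λ (3≤j , j≤) → j , refl , 3≤j , j≤) (λ { (_ , refl , 3≤j , j≤) → 3≤j , j≤ })
    (3 ≤? toℕ j ×-dec toℕ j ≤? 2 + m)

  gap : Fin m → V
  gap i = spine (suc (suc (suc (inject₁ (inject₁ i)))))

  gap-Gap : ∀ i → Gap (gap i)
  gap-Gap i = _ , refl , s≤s (s≤s (s≤s z≤n)) ,
    +-monoʳ-≤ 2 (subst (_< m) (sym (trans (toℕ-inject₁ (inject₁ i)) (toℕ-inject₁ i))) (toℕ<n i))

  gap-injective : Injective _≡_ _≡_ gap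
  gap-injective eq = Finₚ.inject₁-injective (Finₚ.inject₁-injective (spine-suc³-injective eq))
    where
    spine-suc³-injective : ∀ {i j} → spine (suc (suc (suc i))) ≡ (V ∋ spine (suc (suc (suc j)))) → i ≡ j
    spine-suc³-injective refl = refl

  -- An extension has a new vertex since `i` is positive, and that vertex lies in the gap because
  -- the short cycle has all others. Then all `m` gap vertices are new, contrary to `i < m`.
  not-extendable : ∀ {ℓ} (R : Pred ℕ ℓ) → (∀ i → R i → 0 < i) → (∀ i → R i → i < m) → ¬ Extendable R shortCycle
  not-extendable R R>0 R<m (D , i , Ri , short⊆D , ∣new∣≡i) =
    <⇒≱ (R<m i Ri) (≤-trans (injection⇒≤∣∣ new (code ∘ gap) (gap-injective ∘ code-injective) gap∈new) (≤-reflexive ∣new∣≡i))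
    where
    new = vertices D ─ vertices shortCycle
    open CycleNeighbours D using (On)
    on⇒∈ : ∀ {v} → On v → code v ∈ vertices D
    on⇒∈ (j , refl) = subst (_∈ vertices D) (sym (Inverse.strictlyInverseʳ decode _)) (∈-vertices⁺ D j)
    ∈⇒on : ∀ {v} → v ∈ vertices D → On ⟦ v ⟧
    ∈⇒on v∈ = let j , eq = ∈-vertices⁻ D v∈ in j , cong ⟦_⟧ eq
    on : ∀ {v} → ¬ Gap v → On v
    on {v} ¬Gv = subst On (⟦code⟧ v)
      (∈⇒on (short⊆D (¬gap⇒∈short ¬Gv)))
    some-new : Nonempty new
    some-new = 0<∣∣⇒nonempty new (subst (0 <_) (sym ∣new∣≡i) (R>0 i Ri))
    gap-on : ∀ j → On (gap j)
    gap-on j with some-new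
    ... | v , v∈ with gap? ⟦ v ⟧
    ...   | yes Gv = GapAllOrNothing.one⇒all D on Gv (∈⇒on (p─q⊆p (vertices D) (vertices shortCycle) v∈)) (gap-Gap j)
    ...   | no ¬Gv = contradiction
      (subst (_∈ vertices shortCycle) (Inverse.strictlyInverseʳ decode v)
        (¬gap⇒∈short ¬Gv))
      (x∈p─q⇒x∉q (vertices D) (vertices shortCycle) v∈)
    gap∈new : ∀ j → code (gap j) ∈ new
    gap∈new j = x∈p∧x∉q⇒x∈p─q (on⇒∈ (gap-on j)) (gap⇒∉short (gap-Gap j))

  not-cycle-extendable : ∀ {ℓ} (R : Pred ℕ ℓ) → (∀ i → R i → 0 < i) → (∀ i → R i → i < m) → 0 < m →
    ¬ CycleExtendable R graph
  not-cycle-extendable R R>0 R<m 0<m extendable = not-extendable R R>0 R<m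
    (extendable shortCycle λ hamiltonian → gap⇒∉short (gap-Gap (fromℕ< 0<m)) (hamiltonian _))

  counterexample : ∀ {ℓ} (R : Pred ℕ ℓ) → (∀ i → R i → 0 < i) → (∀ i → R i → i < m) → 0 < m →
    Σ[ G ∈ Graph size ]
    (Connected (2 + k) G × Hamiltonian G × StronglyChordal G × ¬ CycleExtendable R G)
  counterexample R R>0 R<m 0<m =
    graph , connected , hamiltonian , (chordal , sun-free) , not-cycle-extendable R R>0 R<m 0<m

-- Choosing the length of the gap

size≡ : ∀ k t o → (2 + k) + (k + (4 + (2 + (5 + (1 + t + o))))) ≡ 14 + t + 2 * k + o
size≡ = solve-∀

theorem1p1 : ∀ {ℓ : Level} (R : Pred ℕ ℓ) → Satisfiable R → (∀ i → R i → 0 < i) →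
    (t : ℕ) → IsMaximum R t →
    (k n : ℕ) → 14 + t + 2 * k ≤ n →
    Σ[ G ∈ Graph n ]
    (Connected (2 + k) G × Hamiltonian G × StronglyChordal G × ¬ CycleExtendable R G)
theorem1p1 R _ R>0 t (_ , R≤t) k n 14+t+2k≤n = subst
  (λ n → Σ[ G ∈ Graph n ] (Connected (2 + k) G × Hamiltonian G × StronglyChordal G × ¬ CycleExtendable R G))
  (trans (size≡ k t o) (m+[n∸m]≡n 14+t+2k≤n))
  -- The gap needs more than `t` vertices to exceed every element of `R`; the surplus `o` brings the
  -- total up to `n`.
  (Construction.counterexample k (1 + t + o) R R>0 (λ i Ri → s≤s (≤-trans (R≤t i Ri) (m≤m+n t o))) z<s)
  where
  o : ℕ
  o = n ∸ (14 + t + 2 * k)
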